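{- Let $p$ be an odd prime and $N_{p-2}$ the number of permutations of $p-2$ letters with an even number of ascents. If $p$ is both a Wilson prime and a super Wieferich prime, then $(2N_{p-2})_0=(2N_{p-2})_1=1$.
   Context: A Wilson prime is a prime $p$ with $(p-1)!\equiv-1\pmod{p^2}$. A super Wieferich prime is a prime $p$ with $\frac{2^{p-1}-1}{p}\equiv0\pmod{p^2}$. For a $p$-adic integer $x$, write $x=\sum_{j\ge0}(x)_jp^j$ with digits $(x)_j\in\{0,\dots,p-1\}$. For a permutation $(i_1,\dots,i_n)$ of $\{1,\dots,n\}$, an ascent is an index $k$ with $i_{k+1}>i_k$. -}

module Defs where

open import Data.Nat using (ℕ; zero; suc; _+_; _*_; _∸_; _^_; _<ᵇ_; NonZero; _!)
open import Data.Nat.DivMod using (_/_; _%_)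
open import Data.Nat.Divisibility using (_∣_)
open import Data.Nat.Properties using (_≟_; m^n≢0)
open import Data.Bool using (if_then_else_)
open import Data.List using (List; []; _∷_; map; concatMap; filter; length; upTo)
open import Relation.Binary.PropositionalEquality using (_≡_)

insertions : ℕ → List ℕ → List (List ℕ)
insertions x [] = (x ∷ []) ∷ []
insertions x (y ∷ ys) = (x ∷ y ∷ ys) ∷ map (y ∷_) (insertions x ys)

permutations : List ℕ → List (List ℕ)
permutations [] = [] ∷ []
permutations (x ∷ xs) = concatMap (insertions x) (permutations xs)

ascents : List ℕ → ℕ
ascents [] = 0
ascents (a ∷ []) = 0
ascents (a ∷ b ∷ rest) = (if a <ᵇ b then 1 else 0) + ascents (b ∷ rest)

N : ℕ → ℕ
N n = length (filter (λ σ → ascents σ % 2 ≟ 0) (permutations (map suc (upTo n))))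

Wilson : ℕ → Set
Wilson p = p ^ 2 ∣ (p ∸ 1) ! + 1

SuperWieferich : (p : ℕ) → .{{NonZero p}} → Set
SuperWieferich p = p ^ 2 ∣ ((2 ^ (p ∸ 1) ∸ 1) / p)

digit : (p : ℕ) → .{{NonZero p}} → ℕ → ℕ → ℕ
digit p x j = ((x / p ^ j) {{m^n≢0 p j}}) % p

{-# OPTIONS --safe #-}

-- Write n = p − 2 and q = p². Then 2 N(n) = n! + D with D = Σ_σ (−1)^asc σ, and the
-- Wilson condition gives n! ≡ 1 + p (mod q), so it suffices that q divides D.
--
-- By Worpitzky's identity Σ_σ C(x + asc σ, n) = xⁿ. Take the alternating sum over
-- 0 ≤ x < q: since q divides C(q, j) for 0 < j ≤ n, Pascal's rule shows that modulo q
-- a unit shift of the argument of C(–, n) only changes the sign of the alternating sum,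
-- and that (−2)ⁿ Σ_x (−1)ˣ C(x, n) ≡ 1. Hence q divides D as soon as it divides
-- Σ_x (−1)ˣ xⁿ.
--
-- Doubling the residues modulo q gives
--   (2ᵏ − 1) Σ_{x<q} xᵏ ≡ k q Σ_{y<q odd} yᵏ⁻¹ (mod q²)
-- for k = p − 1. Fermat's theorem and the super Wieferich condition give p³ ∣ 2ᵏ − 1,
-- and p divides the power sum, so q divides the sum of yⁿ over the odd y. The even
-- residues follow by y ↦ q − y.
module Submission where

open import Defs
open import Data.Bool using (true; false; if_then_else_)
open import Data.Integer as ℤ using (ℤ; +_; _+_; -_; _-_; _^_; 0ℤ; 1ℤ; -1ℤ; ∣_∣; _⊖_)
open import Data.Integer.Divisibility.Signed
import Data.Integer.Properties as ℤ
open import Data.Integer.Tactic.RingSolver using (solve-∀)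
open import Data.List using (List; []; _∷_; _++_; map; concatMap; filter; length; upTo)
open import Data.List.Properties using (length-map; length-upTo)
open import Data.List.Relation.Binary.Permutation.Propositional
  using (_↭_; ↭-refl; ↭-prep; ↭-swap; ↭-trans; ↭-sym)
open import Data.List.Relation.Binary.Permutation.Propositional.Properties
  using (↭-length; All-resp-↭)
open import Data.List.Relation.Unary.All as All using (All; []; _∷_)
import Data.List.Relation.Unary.All.Properties as All
open import Data.List.Relation.Unary.AllPairs using (AllPairs; []; _∷_)
import Data.List.Relation.Unary.AllPairs.Properties as AllPairs
open import Data.Nat as ℕ using (ℕ; zero; suc; _*_; _∸_; NonZero; _!)
open import Data.Nat.Combinatorics using (_C_; nC1≡n; nCn≡1; k>n⇒nCk≡0; nCk+nC[k+1]≡[n+1]C[k+1])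
open import Data.Nat.Coprimality using (Coprime; coprime-divisor; prime⇒coprime; 1-coprimeTo)
open import Data.Nat.DivMod
import Data.Nat.Divisibility as ℕ
open import Data.Nat.Primality using (Prime; ¬prime[1])
import Data.Nat.Properties as ℕ
import Data.Nat.Tactic.RingSolver as ℕ-Solver
open import Data.Product using (_×_; _,_)
open import Data.Sum using (inj₁; inj₂)
open import Function using (_∘_; id)
open import Relation.Binary.PropositionalEquality
open import Relation.Nullary using (contradiction)
open import Relation.Nullary.Reflects using (ofʸ; ofⁿ)
open ≡-Reasoning

-- Finite integer sums

∑ : ℕ → (ℕ → ℤ) → ℤ
∑ zero    f = 0ℤ
∑ (suc n) f = ∑ n f + f n

∑-cong : ∀ {f g} n → (∀ i → i ℕ.< n → f i ≡ g i) → ∑ n f ≡ ∑ n g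
∑-cong zero    eq = refl
∑-cong (suc n) eq = cong₂ _+_ (∑-cong n λ i i<n → eq i (ℕ.m<n⇒m<1+n i<n)) (eq n ℕ.≤-refl)

∑-+ : ∀ n f g → ∑ n (λ i → f i + g i) ≡ ∑ n f + ∑ n g
∑-+ zero    f g = refl
∑-+ (suc n) f g = trans (cong (_+ (f n + g n)) (∑-+ n f g)) (swap (∑ n f) (∑ n g) (f n) (g n))
  where
  swap : ∀ a b c d → a + b + (c + d) ≡ a + c + (b + d)
  swap = solve-∀

∑-*ˡ : ∀ n c f → ∑ n (λ i → c ℤ.* f i) ≡ c ℤ.* ∑ n f
∑-*ˡ zero    c f = sym (ℤ.*-zeroʳ c)
∑-*ˡ (suc n) c f = trans (cong (_+ c ℤ.* f n) (∑-*ˡ n c f)) (sym (ℤ.*-distribˡ-+ c (∑ n f) (f n)))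

∑-∣ : ∀ {m f} n → (∀ i → i ℕ.< n → m ∣ f i) → m ∣ ∑ n f
∑-∣ zero    m∣f = divides 0ℤ refl
∑-∣ (suc n) m∣f = ∣m∣n⇒∣m+n (∑-∣ n λ i i<n → m∣f i (ℕ.m<n⇒m<1+n i<n)) (m∣f n ℕ.≤-refl)

∑-- : ∀ n f g → ∑ n (λ i → f i - g i) ≡ ∑ n f - ∑ n g
∑-- n f g = begin
  ∑ n (λ i → f i - g i)           ≡⟨ ∑-+ n f (λ i → - g i) ⟩
  ∑ n f + ∑ n (λ i → - g i)       ≡⟨ cong (_+_ (∑ n f)) (∑-cong n λ i _ → sym (ℤ.-1*i≡-i (g i))) ⟩
  ∑ n f + ∑ n (λ i → -1ℤ ℤ.* g i) ≡⟨ cong (_+_ (∑ n f)) (∑-*ˡ n -1ℤ g) ⟩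
  ∑ n f + -1ℤ ℤ.* ∑ n g           ≡⟨ cong (_+_ (∑ n f)) (ℤ.-1*i≡-i (∑ n g)) ⟩
  ∑ n f - ∑ n g                   ∎

∑-∣- : ∀ {m f g} n → (∀ i → i ℕ.< n → m ∣ f i - g i) → m ∣ ∑ n f - ∑ n g
∑-∣- {m} {f} {g} n m∣f-g = subst (m ∣_) (∑-- n f g) (∑-∣ n m∣f-g)

∑-++ : ∀ m n f → ∑ (m ℕ.+ n) f ≡ ∑ m f + ∑ n (λ i → f (m ℕ.+ i))
∑-++ m zero    f = trans (cong (λ l → ∑ l f) (ℕ.+-identityʳ m)) (sym (ℤ.+-identityʳ _))
∑-++ m (suc n) f = begin
  ∑ (m ℕ.+ suc n) f                             ≡⟨ cong (λ l → ∑ l f) (ℕ.+-suc m n) ⟩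
  ∑ (m ℕ.+ n) f + f (m ℕ.+ n)                   ≡⟨ cong (_+ f (m ℕ.+ n)) (∑-++ m n f) ⟩
  ∑ m f + ∑ n (λ i → f (m ℕ.+ i)) + f (m ℕ.+ n) ≡⟨ ℤ.+-assoc (∑ m f) _ _ ⟩
  _                                             ∎

∑-head : ∀ n f → ∑ (suc n) f ≡ f 0 + ∑ n (f ∘ suc)
∑-head n f = trans (∑-++ 1 n f) (cong (_+ ∑ n (f ∘ suc)) (ℤ.+-identityˡ (f 0)))

∑-reverse : ∀ n f → ∑ n f ≡ ∑ n (λ i → f (n ∸ suc i))
∑-reverse zero    f = refl
∑-reverse (suc n) f = begin
  ∑ n f + f n                         ≡⟨ ℤ.+-comm (∑ n f) (f n) ⟩
  f n + ∑ n f                         ≡⟨ cong (_+_ (f n)) (∑-reverse n f) ⟩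
  f n + ∑ n (λ i → f (n ∸ suc i))     ≡⟨ ∑-head n (λ i → f (n ∸ i)) ⟨
  ∑ (suc n) (λ i → f (suc n ∸ suc i)) ∎

∑-parity : ∀ h f → ∑ (suc (h ℕ.+ h)) f ≡ ∑ (suc h) (λ m → f (m ℕ.+ m)) + ∑ h (λ m → f (suc (m ℕ.+ m)))
∑-parity zero    f = sym (ℤ.+-identityʳ _)
∑-parity (suc h) f rewrite ℕ.+-suc h h =
  trans (cong (λ s → s + f (suc (h ℕ.+ h)) + f (suc (suc (h ℕ.+ h)))) (∑-parity h f))
    (swap (∑ (suc h) (λ m → f (m ℕ.+ m))) (∑ h (λ m → f (suc (m ℕ.+ m)))) _ _)
  where
  swap : ∀ a b c d → a + b + c + d ≡ a + d + (b + c)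
  swap = solve-∀

-- Binomial coefficients

infix 8 _choose_
_choose_ : ℕ → ℕ → ℤ
n choose k = + (n C k)

choose-pascal : ∀ n k → suc n choose suc k ≡ n choose k + n choose suc k
choose-pascal n k = cong +_ (sym (nCk+nC[k+1]≡[n+1]C[k+1] n k))

-- Taking the difference in ℤ makes the identity uniform in a and n: for a < n both binomials
-- vanish, and for a = n the factor `+ a - + n` does.
choose-sucʳ : ∀ a n → + suc n ℤ.* a choose suc n ≡ (+ a - + n) ℤ.* a choose n
choose-sucʳ zero    zero    = refl
choose-sucʳ zero    (suc n) = trans (ℤ.*-zeroʳ (+ suc (suc n))) (sym (ℤ.*-zeroʳ (0ℤ - + suc n)))
choose-sucʳ (suc a) zero    = trans (cong (λ c → + 1 ℤ.* + c) (nC1≡n (suc a))) (simplify (+ suc a))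
  where
  simplify : ∀ x → 1ℤ ℤ.* x ≡ (x - 0ℤ) ℤ.* 1ℤ
  simplify = solve-∀
choose-sucʳ (suc a) (suc n) = begin
  + suc (suc n) ℤ.* suc a choose suc (suc n)         ≡⟨ cong (+ suc (suc n) ℤ.*_) (choose-pascal a (suc n)) ⟩
  + suc (suc n) ℤ.* (y + z)                          ≡⟨ expand (+ n) y z ⟩
  (1ℤ + (1ℤ + + n)) ℤ.* y + + suc (suc n) ℤ.* z      ≡⟨ cong (_+_ ((1ℤ + (1ℤ + + n)) ℤ.* y)) (choose-sucʳ a (suc n)) ⟩
  (1ℤ + (1ℤ + + n)) ℤ.* y + (+ a - (1ℤ + + n)) ℤ.* y ≡⟨ regroup (+ a) (+ n) y ⟩
  (1ℤ + + n) ℤ.* y + (+ a - + n) ℤ.* y               ≡⟨ cong (_+ (+ a - + n) ℤ.* y) (choose-sucʳ a n) ⟩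
  (+ a - + n) ℤ.* x + (+ a - + n) ℤ.* y              ≡⟨ collect (+ a) (+ n) x y ⟩
  (+ suc a - + suc n) ℤ.* (x + y)                    ≡⟨ cong ((+ suc a - + suc n) ℤ.*_) (choose-pascal a n) ⟨
  (+ suc a - + suc n) ℤ.* suc a choose suc n         ∎
  where
  x = a choose n
  y = a choose suc n
  z = a choose suc (suc n)
  expand : ∀ n y z → (1ℤ + (1ℤ + n)) ℤ.* (y + z) ≡ (1ℤ + (1ℤ + n)) ℤ.* y + (1ℤ + (1ℤ + n)) ℤ.* z
  expand = solve-∀
  regroup : ∀ a n y → (1ℤ + (1ℤ + n)) ℤ.* y + (a - (1ℤ + n)) ℤ.* y ≡ (1ℤ + n) ℤ.* y + (a - n) ℤ.* y
  regroup = solve-∀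
  collect : ∀ a n x y → (a - n) ℤ.* x + (a - n) ℤ.* y ≡ (1ℤ + a - (1ℤ + n)) ℤ.* (x + y)
  collect = solve-∀

choose-absorb : ∀ a n → + suc n ℤ.* suc a choose suc n ≡ + suc a ℤ.* a choose n
choose-absorb a n = begin
  + suc n ℤ.* suc a choose suc n                      ≡⟨ cong (+ suc n ℤ.*_) (choose-pascal a n) ⟩
  + suc n ℤ.* (a choose n + a choose suc n)           ≡⟨ ℤ.*-distribˡ-+ (+ suc n) (a choose n) (a choose suc n) ⟩
  + suc n ℤ.* a choose n + + suc n ℤ.* a choose suc n ≡⟨ cong (_+_ (+ suc n ℤ.* a choose n)) (choose-sucʳ a n) ⟩
  + suc n ℤ.* a choose n + (+ a - + n) ℤ.* a choose n ≡⟨ collect (+ a) (+ n) (a choose n) ⟩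
  + suc a ℤ.* a choose n                              ∎
  where
  collect : ∀ a n x → (1ℤ + n) ℤ.* x + (a - n) ℤ.* x ≡ (1ℤ + a) ℤ.* x
  collect = solve-∀

-- Powers, coprimality and binomial coefficients divisible by the modulus

^-distrib-* : ∀ x y n → (x ℤ.* y) ^ n ≡ x ^ n ℤ.* y ^ n
^-distrib-* x y zero    = refl
^-distrib-* x y (suc n) = trans (cong (x ℤ.* y ℤ.*_) (^-distrib-* x y n)) (swap x y (x ^ n) (y ^ n))
  where
  swap : ∀ x y a b → x ℤ.* y ℤ.* (a ℤ.* b) ≡ x ℤ.* a ℤ.* (y ℤ.* b)
  swap = solve-∀

pos-^ : ∀ m n → + (m ℕ.^ n) ≡ (+ m) ^ n
pos-^ m zero    = refl
pos-^ m (suc n) = trans (ℤ.pos-* m (m ℕ.^ n)) (cong (+ m ℤ.*_) (pos-^ m n))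

^-∣- : ∀ {m x y} n → m ∣ x - y → m ∣ x ^ n - y ^ n
^-∣- zero    m∣x-y = divides 0ℤ refl
^-∣- {m} {x} {y} (suc n) m∣x-y =
  subst (m ∣_) (eq x y (x ^ n) (y ^ n))
    (∣m∣n⇒∣m+n (∣n⇒∣m*n x (^-∣- n m∣x-y)) (∣n⇒∣m*n (y ^ n) m∣x-y))
  where
  eq : ∀ x y a b → x ℤ.* (a - b) + b ℤ.* (x - y) ≡ x ℤ.* a - y ℤ.* b
  eq = solve-∀

coprime-*ˡ : ∀ {m n o} → Coprime m o → Coprime n o → Coprime (m ℕ.* n) o
coprime-*ˡ {m} m⊥o n⊥o (d∣mn , d∣o) =
  n⊥o (coprime-divisor (λ (e∣d , e∣m) → m⊥o (e∣m , ℕ.∣-trans e∣d d∣o)) d∣mn , d∣o)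

coprime-^ˡ : ∀ {m o} k → Coprime m o → Coprime (m ℕ.^ k) o
coprime-^ˡ zero    m⊥o = 1-coprimeTo _
coprime-^ˡ (suc k) m⊥o = coprime-*ˡ m⊥o (coprime-^ˡ k m⊥o)

prime-^-coprime : ∀ {p n} k → Prime p → suc n ℕ.< p → Coprime (p ℕ.^ k) (suc n)
prime-^-coprime k p-prime n<p = coprime-^ˡ k (prime⇒coprime p-prime n<p)

coprime-cancelˡ : ∀ {m n} x → Coprime m n → + m ∣ + n ℤ.* x → + m ∣ x
coprime-cancelˡ {m} {n} x m⊥n m∣nx =
  ∣ᵤ⇒∣ (coprime-divisor m⊥n (subst (m ℕ.∣_) (ℤ.abs-* (+ n) x) (∣⇒∣ᵤ m∣nx)))

-- The index `suc j` leaves out C(q, 0) = 1, so the lower arguments run over 1, ..., n.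
DividesChoose : ℕ → ℕ → Set
DividesChoose q n = ∀ {j} → j ℕ.< n → + q ∣ q choose suc j

-- Absorption writes (j + 1) C(q, j + 1) as q C(q - 1, j), and the factor j + 1 is coprime to q.
coprime⇒dividesChoose : ∀ {q n} → .{{NonZero q}} → (∀ {j} → j ℕ.< n → Coprime q (suc j)) → DividesChoose q n
coprime⇒dividesChoose {q@(suc q-1)} q⊥ {j} j<n = coprime-cancelˡ (q choose suc j) (q⊥ j<n)
  (subst (+ q ∣_) (sym (choose-absorb q-1 j)) (∣m⇒∣m*n (q-1 choose j) ∣-refl))

-- Applying Pascal's rule k times leaves only C(q, i) with j - k ≤ i ≤ j; the bound k < j keeps i
-- positive.
dividesChoose-+ : ∀ {q n} → DividesChoose q n → ∀ k {j} → k ℕ.< j → j ℕ.≤ n → + q ∣ (q ℕ.+ k) choose j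
dividesChoose-+ {q} H zero    {suc j} _   j<n = subst (λ a → + q ∣ a choose suc j) (sym (ℕ.+-identityʳ q)) (H j<n)
dividesChoose-+ {q} H (suc k) {suc j} (ℕ.s≤s k<j) j<n =
  subst (+ q ∣_) (sym (trans (cong (_choose suc j) (ℕ.+-suc q k)) (choose-pascal (q ℕ.+ k) j)))
    (∣m∣n⇒∣m+n (dividesChoose-+ H k k<j (ℕ.<⇒≤ j<n)) (dividesChoose-+ H k (ℕ.m<n⇒m<1+n k<j) j<n))

-- Alternating sums

alt : ℕ → (ℕ → ℤ) → ℤ
alt n f = ∑ n (λ x → -1ℤ ^ x ℤ.* f x)

alt-cong : ∀ {f g} n → (∀ x → f x ≡ g x) → alt n f ≡ alt n g
alt-cong n eq = ∑-cong n λ x _ → cong (-1ℤ ^ x ℤ.*_) (eq x)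

alt-+ : ∀ n f g → alt n (λ x → f x + g x) ≡ alt n f + alt n g
alt-+ n f g = trans (∑-cong n λ x _ → ℤ.*-distribˡ-+ (-1ℤ ^ x) (f x) (g x)) (∑-+ n _ _)

-- Reindexing by one flips every sign; the first term of the old range and the one just past its end
-- remain as boundary terms.
alt-shift : ∀ n f → alt n (f ∘ suc) ≡ f 0 - -1ℤ ^ n ℤ.* f n - alt n f
alt-shift zero    f = cancel (f 0)
  where
  cancel : ∀ a → 0ℤ ≡ a - 1ℤ ℤ.* a - 0ℤ
  cancel = solve-∀
alt-shift (suc n) f = trans (cong (_+ -1ℤ ^ n ℤ.* f (suc n)) (alt-shift n f))
    (regroup (f 0) (-1ℤ ^ n) (f n) (f (suc n)) (alt n f))
  where
  regroup : ∀ a s b c t → a - s ℤ.* b - t + s ℤ.* c ≡ a - -1ℤ ℤ.* s ℤ.* c - (t + s ℤ.* b)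
  regroup = solve-∀

-1^[m+m]≡1 : ∀ m → -1ℤ ^ (m ℕ.+ m) ≡ 1ℤ
-1^[m+m]≡1 m = begin
  -1ℤ ^ (m ℕ.+ m)     ≡⟨ ℤ.^-distribˡ-+-* -1ℤ m m ⟩
  -1ℤ ^ m ℤ.* -1ℤ ^ m ≡⟨ ^-distrib-* -1ℤ -1ℤ m ⟨
  1ℤ ^ m              ≡⟨ ℤ.^-zeroˡ m ⟩
  1ℤ                  ∎

module OddLength {q} h (q-odd : q ≡ suc (h ℕ.+ h)) where

  -1^q≡-1 : -1ℤ ^ q ≡ -1ℤ
  -1^q≡-1 = trans (cong (-1ℤ ^_) q-odd) (cong (-1ℤ ℤ.*_) (-1^[m+m]≡1 h))

  -- For odd q both boundary terms enter with a plus sign.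
  alt-shift-odd : ∀ f → alt q (f ∘ suc) ≡ f 0 + f q - alt q f
  alt-shift-odd f = trans (alt-shift q f)
      (trans (cong (λ s → f 0 - s ℤ.* f q - alt q f) -1^q≡-1) (simplify (f 0) (f q) (alt q f)))
    where
    simplify : ∀ a b t → a - -1ℤ ℤ.* b - t ≡ a + b - t
    simplify = solve-∀

  alt-parity : ∀ f → alt q f ≡ ∑ (suc h) (λ m → f (m ℕ.+ m)) - ∑ h (λ m → f (suc (m ℕ.+ m)))
  alt-parity f = begin
    alt q f               ≡⟨ cong (λ l → alt l f) q-odd ⟩
    alt (suc (h ℕ.+ h)) f ≡⟨ ∑-parity h (λ x → -1ℤ ^ x ℤ.* f x) ⟩
    ∑ (suc h) (λ m → -1ℤ ^ (m ℕ.+ m) ℤ.* f (m ℕ.+ m)) + ∑ h (λ m → -1ℤ ^ suc (m ℕ.+ m) ℤ.* f (suc (m ℕ.+ m)))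
      ≡⟨ cong₂ _+_
           (∑-cong (suc h) λ m _ → trans (cong (ℤ._* f (m ℕ.+ m)) (-1^[m+m]≡1 m)) (ℤ.*-identityˡ _))
           (∑-cong h λ m _ → cong (λ s → -1ℤ ℤ.* s ℤ.* f (suc (m ℕ.+ m))) (-1^[m+m]≡1 m)) ⟩
    ∑ (suc h) (λ m → f (m ℕ.+ m)) + ∑ h (λ m → -1ℤ ℤ.* f (suc (m ℕ.+ m)))
      ≡⟨ cong (_+_ (∑ (suc h) (λ m → f (m ℕ.+ m)))) (trans (∑-*ˡ h -1ℤ (λ m → f (suc (m ℕ.+ m)))) (ℤ.-1*i≡-i _)) ⟩
    ∑ (suc h) (λ m → f (m ℕ.+ m)) - ∑ h (λ m → f (suc (m ℕ.+ m))) ∎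

  alt-1 : alt q (λ _ → 1ℤ) ≡ 1ℤ
  alt-1 = begin
    alt q (λ _ → 1ℤ)                     ≡⟨ alt-parity (λ _ → 1ℤ) ⟩
    ∑ h (λ _ → 1ℤ) + 1ℤ - ∑ h (λ _ → 1ℤ) ≡⟨ cancel (∑ h (λ _ → 1ℤ)) ⟩
    1ℤ                                   ∎
    where
    cancel : ∀ a → a + 1ℤ - a ≡ 1ℤ
    cancel = solve-∀

  -- Write a(n) for the alternating sum of C(x, n). Pascal's rule turns the shifted sum of C(x, n +
  -- 1) into a(n) + a(n + 1), while the boundary formula gives C(q, n + 1) - a(n + 1). Hence a(n) ≡
  -- -2 a(n + 1) modulo q, starting from a(0) = 1.
  alt-choose-normalised : ∀ n → DividesChoose q n → + q ∣ (- + 2) ^ n ℤ.* alt q (_choose n) - 1ℤ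
  alt-choose-normalised zero    H = subst (λ a → + q ∣ 1ℤ ℤ.* a - 1ℤ) (sym alt-1) (divides 0ℤ refl)
  alt-choose-normalised (suc n) H = subst (+ q ∣_) eq
      (∣m∣n⇒∣m-n (alt-choose-normalised n (H ∘ ℕ.m<n⇒m<1+n)) (∣n⇒∣m*n ((- + 2) ^ n) (H ℕ.≤-refl)))
    where
    a = alt q (_choose n)
    a′ = alt q (_choose suc n)
    c = q choose suc n
    shifted : a + a′ ≡ 0ℤ + c - a′
    shifted = trans (sym (alt-+ q (_choose n) (_choose suc n)))
      (trans (alt-cong q λ x → sym (choose-pascal x n)) (alt-shift-odd (_choose suc n)))
    isolate : ∀ a a′ → a + a′ - a′ ≡ a
    isolate = solve-∀
    regroup : ∀ w c a′ → w ℤ.* (0ℤ + c - a′ - a′) - 1ℤ - w ℤ.* c ≡ (- + 2) ℤ.* w ℤ.* a′ - 1ℤ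
    regroup = solve-∀
    eq : (- + 2) ^ n ℤ.* a - 1ℤ - (- + 2) ^ n ℤ.* c ≡ (- + 2) ^ suc n ℤ.* a′ - 1ℤ
    eq = begin
      (- + 2) ^ n ℤ.* a - 1ℤ - (- + 2) ^ n ℤ.* c
        ≡⟨ cong (λ b → (- + 2) ^ n ℤ.* b - 1ℤ - (- + 2) ^ n ℤ.* c)
             (trans (sym (isolate a a′)) (cong (_- a′) shifted)) ⟩
      (- + 2) ^ n ℤ.* (0ℤ + c - a′ - a′) - 1ℤ - (- + 2) ^ n ℤ.* c
        ≡⟨ regroup ((- + 2) ^ n) c a′ ⟩
      (- + 2) ^ suc n ℤ.* a′ - 1ℤ ∎

  -- Each unit shift changes the sign and adds two boundary terms: C(k, n) is zero because k < n,
  -- and q divides C(q + k, n) by `dividesChoose-+`.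
  alt-choose-shift : ∀ {n} → DividesChoose q n → ∀ k → k ℕ.≤ n →
    + q ∣ alt q (λ x → (x ℕ.+ k) choose n) - -1ℤ ^ k ℤ.* alt q (_choose n)
  alt-choose-shift {n} H zero    _   = subst (λ a → + q ∣ a - 1ℤ ℤ.* alt q (_choose n))
    (alt-cong q λ x → cong (_choose n) (sym (ℕ.+-identityʳ x)))
    (subst (+ q ∣_) (cancel (alt q (_choose n))) (divides 0ℤ refl))
    where
    cancel : ∀ a → 0ℤ ≡ a - 1ℤ ℤ.* a
    cancel = solve-∀
  alt-choose-shift {n} H (suc k) k<n = subst (+ q ∣_) eq
      (∣m∣n⇒∣m-n (dividesChoose-+ H k k<n ℕ.≤-refl) (alt-choose-shift H k (ℕ.<⇒≤ k<n)))
    where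
    b = alt q (λ x → (x ℕ.+ k) choose n)
    c = (q ℕ.+ k) choose n
    t = -1ℤ ^ k ℤ.* alt q (_choose n)
    shifted : alt q (λ x → (x ℕ.+ suc k) choose n) ≡ 0ℤ + c - b
    shifted = begin
      alt q (λ x → (x ℕ.+ suc k) choose n) ≡⟨ alt-cong q (λ x → cong (_choose n) (ℕ.+-suc x k)) ⟩
      alt q (λ x → (suc x ℕ.+ k) choose n) ≡⟨ alt-shift-odd (λ x → (x ℕ.+ k) choose n) ⟩
      k choose n + c - b                   ≡⟨ cong (λ a → + a + c - b) (k>n⇒nCk≡0 k<n) ⟩
      0ℤ + c - b                           ∎
    regroup : ∀ c b s u → c - (b - s ℤ.* u) ≡ 0ℤ + c - b - -1ℤ ℤ.* s ℤ.* u
    regroup = solve-∀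
    eq : c - (b - t) ≡ alt q (λ x → (x ℕ.+ suc k) choose n) - -1ℤ ^ suc k ℤ.* alt q (_choose n)
    eq = trans (regroup c b (-1ℤ ^ k) (alt q (_choose n)))
      (cong (_- -1ℤ ^ suc k ℤ.* alt q (_choose n)) (sym shifted))

-- Eulerian sums over permutations

private variable
  A B : Set

listSum : (A → ℤ) → List A → ℤ
listSum f []       = 0ℤ
listSum f (a ∷ as) = f a + listSum f as

listSum-cong : ∀ {f g : A → ℤ} {as} → All (λ a → f a ≡ g a) as → listSum f as ≡ listSum g as
listSum-cong []         = refl
listSum-cong (eq ∷ eqs) = cong₂ _+_ eq (listSum-cong eqs)

listSum-++ : ∀ (f : A → ℤ) as bs → listSum f (as ++ bs) ≡ listSum f as + listSum f bs
listSum-++ f []       bs = sym (ℤ.+-identityˡ _)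
listSum-++ f (a ∷ as) bs = trans (cong (_+_ (f a)) (listSum-++ f as bs)) (sym (ℤ.+-assoc (f a) _ _))

listSum-map : ∀ (f : B → ℤ) (g : A → B) as → listSum f (map g as) ≡ listSum (f ∘ g) as
listSum-map f g []       = refl
listSum-map f g (a ∷ as) = cong (_+_ (f (g a))) (listSum-map f g as)

listSum-concatMap : ∀ (f : B → ℤ) (g : A → List B) as →
  listSum f (concatMap g as) ≡ listSum (listSum f ∘ g) as
listSum-concatMap f g []       = refl
listSum-concatMap f g (a ∷ as) =
  trans (listSum-++ f (g a) (concatMap g as)) (cong (_+_ (listSum f (g a))) (listSum-concatMap f g as))

listSum-+ : ∀ (f g : A → ℤ) as → listSum (λ a → f a + g a) as ≡ listSum f as + listSum g as
listSum-+ f g []       = refl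
listSum-+ f g (a ∷ as) = trans (cong (_+_ (f a + g a)) (listSum-+ f g as))
    (swap (f a) (g a) (listSum f as) (listSum g as))
  where
  swap : ∀ a b c d → a + b + (c + d) ≡ a + c + (b + d)
  swap = solve-∀

listSum-*ˡ : ∀ c (f : A → ℤ) as → listSum (λ a → c ℤ.* f a) as ≡ c ℤ.* listSum f as
listSum-*ˡ c f []       = sym (ℤ.*-zeroʳ c)
listSum-*ˡ c f (a ∷ as) = trans (cong (_+_ (c ℤ.* f a)) (listSum-*ˡ c f as))
  (sym (ℤ.*-distribˡ-+ c (f a) (listSum f as)))

listSum-∣ : ∀ {m} {f : A → ℤ} {as} → All (λ a → m ∣ f a) as → m ∣ listSum f as
listSum-∣ []       = divides 0ℤ refl
listSum-∣ (d ∷ ds) = ∣m∣n⇒∣m+n d (listSum-∣ ds)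

listSum-∑ : ∀ n (f : ℕ → A → ℤ) as → listSum (λ a → ∑ n (λ x → f x a)) as ≡ ∑ n (λ x → listSum (f x) as)
listSum-∑ zero    f []       = refl
listSum-∑ zero    f (a ∷ as) = trans (ℤ.+-identityˡ _) (listSum-∑ zero f as)
listSum-∑ (suc n) f as = trans (listSum-+ (λ a → ∑ n (λ x → f x a)) (f n) as)
  (cong (_+ listSum (f n) as) (listSum-∑ n f as))

insertions-↭ : ∀ x ys → All (_↭ x ∷ ys) (insertions x ys)
insertions-↭ x []       = ↭-refl ∷ []
insertions-↭ x (y ∷ ys) = ↭-refl ∷
  All.map⁺ (All.map (λ τ↭ → ↭-trans (↭-prep y τ↭) (↭-swap y x ↭-refl)) (insertions-↭ x ys))

-- Carries the length of xs and the minimality of a new head over to every listed permutation.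
permutations-↭ : ∀ xs → All (_↭ xs) (permutations xs)
permutations-↭ []       = ↭-refl ∷ []
permutations-↭ (x ∷ xs) = All.concat⁺ (All.map⁺ (All.map
  (λ {σ} σ↭ → All.map (λ τ↭ → ↭-trans τ↭ (↭-prep x σ↭)) (insertions-↭ x σ)) (permutations-↭ xs)))

-- Inserting a new minimum at the end of a list or inside one of its ascents
-- keeps the number of ascents; at the front or inside a descent it adds one.
eulerStep : ℕ → (ℕ → ℤ) → ℕ → ℤ
eulerStep n w k = + suc k ℤ.* w k + (+ n - + k) ℤ.* w (suc k)

ascent : ℕ → ℕ → ℕ
ascent a b = if a ℕ.<ᵇ b then 1 else 0

<⇒ascent≡1 : ∀ {a b} → a ℕ.< b → ascent a b ≡ 1
<⇒ascent≡1 {a} {b} a<b with a ℕ.<ᵇ b | ℕ.<ᵇ-reflects-< a b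
... | true  | _        = refl
... | false | ofⁿ a≮b  = contradiction a<b a≮b

>⇒ascent≡0 : ∀ {a b} → b ℕ.< a → ascent a b ≡ 0
>⇒ascent≡0 {a} {b} b<a with a ℕ.<ᵇ b | ℕ.<ᵇ-reflects-< a b
... | true  | ofʸ a<b  = contradiction a<b (ℕ.<-asym b<a)
... | false | _        = refl

-- Keeping y in front leaves one place after each entry of `y ∷ ys`. The recursion moves past y; the
-- step from y to z then contributes a constant to every count, which is absorbed into the weight w.
insertions-after : ∀ w x y ys → All (x ℕ.<_) (y ∷ ys) →
  listSum (λ τ → w (ascents (y ∷ τ))) (insertions x ys) ≡ eulerStep (length ys) w (ascents (y ∷ ys))
insertions-after w x y [] (x<y ∷ []) = begin
  w (ascent y x ℕ.+ 0) + 0ℤ ≡⟨ cong (λ a → w (a ℕ.+ 0) + 0ℤ) (>⇒ascent≡0 x<y) ⟩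
  w 0 + 0ℤ                  ≡⟨ simplify (w 0) (w 1) ⟩
  eulerStep 0 w 0           ∎
  where
  simplify : ∀ a b → a + 0ℤ ≡ 1ℤ ℤ.* a + (0ℤ - 0ℤ) ℤ.* b
  simplify = solve-∀
insertions-after w x y (z ∷ zs) (x<y ∷ x<zzs@(x<z ∷ _)) = begin
  w (ascent y x ℕ.+ (ascent x z ℕ.+ k)) + listSum (λ τ → w (ascents (y ∷ τ))) (map (z ∷_) (insertions x zs))
    ≡⟨ cong₂ _+_ (cong₂ (λ a b → w (a ℕ.+ (b ℕ.+ k))) (>⇒ascent≡0 x<y) (<⇒ascent≡1 x<z))
         (trans (listSum-map (λ τ → w (ascents (y ∷ τ))) (z ∷_) (insertions x zs))
                (insertions-after (λ i → w (ascent y z ℕ.+ i)) x z zs x<zzs)) ⟩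
  w (suc k) + eulerStep (length zs) (λ i → w (ascent y z ℕ.+ i)) k
    ≡⟨ combine (y ℕ.<ᵇ z) ⟩
  eulerStep (suc (length zs)) w (ascent y z ℕ.+ k) ∎
  where
  k = ascents (z ∷ zs)
  m = length zs
  descending : ∀ k m a b → b + ((1ℤ + k) ℤ.* a + (m - k) ℤ.* b) ≡ (1ℤ + k) ℤ.* a + (1ℤ + m - k) ℤ.* b
  descending = solve-∀
  ascending : ∀ k m a b → a + ((1ℤ + k) ℤ.* a + (m - k) ℤ.* b) ≡ (1ℤ + (1ℤ + k)) ℤ.* a + (1ℤ + m - (1ℤ + k)) ℤ.* b
  ascending = solve-∀
  combine : ∀ e → w (suc k) + eulerStep m (λ i → w ((if e then 1 else 0) ℕ.+ i)) k
                ≡ eulerStep (suc m) w ((if e then 1 else 0) ℕ.+ k)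
  combine false = descending (+ k) (+ m) (w k) (w (suc k))
  combine true  = ascending (+ k) (+ m) (w (suc k)) (w (suc (suc k)))

-- In front of a nonempty list the minimum x creates an ascent; the other places are counted by
-- `insertions-after`.
insertions-ascents : ∀ w x ys → All (x ℕ.<_) ys →
  listSum (w ∘ ascents) (insertions x ys) ≡ eulerStep (length ys) w (ascents ys)
insertions-ascents w x [] [] = simplify (w 0) (w 1)
  where
  simplify : ∀ a b → a + 0ℤ ≡ 1ℤ ℤ.* a + (0ℤ - 0ℤ) ℤ.* b
  simplify = solve-∀
insertions-ascents w x (y ∷ ys) x<yys@(x<y ∷ _) = begin
  w (ascent x y ℕ.+ k) + listSum (w ∘ ascents) (map (y ∷_) (insertions x ys))
    ≡⟨ cong₂ _+_ (cong (λ a → w (a ℕ.+ k)) (<⇒ascent≡1 x<y))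
         (trans (listSum-map (w ∘ ascents) (y ∷_) (insertions x ys)) (insertions-after w x y ys x<yys)) ⟩
  w (suc k) + eulerStep (length ys) w k
    ≡⟨ combine (+ k) (+ length ys) (w k) (w (suc k)) ⟩
  eulerStep (suc (length ys)) w k ∎
  where
  k = ascents (y ∷ ys)
  combine : ∀ k m a b → b + ((1ℤ + k) ℤ.* a + (m - k) ℤ.* b) ≡ (1ℤ + k) ℤ.* a + (1ℤ + m - k) ℤ.* b
  combine = solve-∀

euler : (ℕ → ℤ) → List ℕ → ℤ
euler w xs = listSum (w ∘ ascents) (permutations xs)

euler-cong : ∀ {v w} → (∀ k → v k ≡ w k) → ∀ xs → euler v xs ≡ euler w xs
euler-cong v≡w xs = listSum-cong (All.universal (v≡w ∘ ascents) (permutations xs))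

-- The Eulerian recurrence acts on the weight, so identities for `euler` follow by induction on the
-- list with the weight varying.
euler-∷ : ∀ w {x xs} → All (x ℕ.<_) xs → euler w (x ∷ xs) ≡ euler (eulerStep (length xs) w) xs
euler-∷ w {x} {xs} x<xs = trans
  (listSum-concatMap (w ∘ ascents) (insertions x) (permutations xs))
  (listSum-cong (All.map
    (λ {σ} σ↭xs → trans (insertions-ascents w x σ (All-resp-↭ (↭-sym σ↭xs) x<xs))
                        (cong (λ n → eulerStep n w (ascents σ)) (↭-length σ↭xs)))
    (permutations-↭ xs)))

euler-*ˡ : ∀ c w xs → euler (λ k → c ℤ.* w k) xs ≡ c ℤ.* euler w xs
euler-*ˡ c w xs = listSum-*ˡ c (w ∘ ascents) (permutations xs)

-- The Eulerian recurrence sends the weight C(x + k, n + 1) to x C(x + k, n), so each list entry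
-- splits off one factor x.
worpitzky : ∀ x {xs} → AllPairs ℕ._<_ xs → euler (λ k → (x ℕ.+ k) choose length xs) xs ≡ (+ x) ^ length xs
worpitzky x []                      = refl
worpitzky x {_ ∷ xs} (x₁<xs ∷ xs<) = begin
  euler (λ k → (x ℕ.+ k) choose suc n) (_ ∷ xs)         ≡⟨ euler-∷ (λ k → (x ℕ.+ k) choose suc n) x₁<xs ⟩
  euler (eulerStep n (λ k → (x ℕ.+ k) choose suc n)) xs ≡⟨ euler-cong step xs ⟩
  euler (λ k → + x ℤ.* (x ℕ.+ k) choose n) xs           ≡⟨ euler-*ˡ (+ x) (λ k → (x ℕ.+ k) choose n) xs ⟩
  + x ℤ.* euler (λ k → (x ℕ.+ k) choose n) xs           ≡⟨ cong (+ x ℤ.*_) (worpitzky x xs<) ⟩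
  + x ℤ.* (+ x) ^ n                                     ∎
  where
  n = length xs
  step : ∀ k → eulerStep n (λ k → (x ℕ.+ k) choose suc n) k ≡ + x ℤ.* (x ℕ.+ k) choose n
  step k = begin
    + suc k ℤ.* d + (+ n - + k) ℤ.* (x ℕ.+ suc k) choose suc n
      ≡⟨ cong (λ e → + suc k ℤ.* d + (+ n - + k) ℤ.* e)
           (trans (cong (_choose suc n) (ℕ.+-suc x k)) (choose-pascal (x ℕ.+ k) n)) ⟩
    + suc k ℤ.* d + (+ n - + k) ℤ.* (c + d)     ≡⟨ regroup (+ k) (+ n) c d ⟩
    + suc n ℤ.* d + (+ n - + k) ℤ.* c           ≡⟨ cong (_+ (+ n - + k) ℤ.* c) (choose-sucʳ (x ℕ.+ k) n) ⟩
    (+ x + + k - + n) ℤ.* c + (+ n - + k) ℤ.* c ≡⟨ collect (+ x) (+ k) (+ n) c ⟩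
    + x ℤ.* c                                   ∎
    where
    c = (x ℕ.+ k) choose n
    d = (x ℕ.+ k) choose suc n
    regroup : ∀ k n c d → (1ℤ + k) ℤ.* d + (n - k) ℤ.* (c + d) ≡ (1ℤ + n) ℤ.* d + (n - k) ℤ.* c
    regroup = solve-∀
    collect : ∀ x k n c → (x + k - n) ℤ.* c + (n - k) ℤ.* c ≡ x ℤ.* c
    collect = solve-∀

euler-1 : ∀ {xs} → AllPairs ℕ._<_ xs → euler (λ _ → 1ℤ) xs ≡ + (length xs !)
euler-1 []                      = refl
euler-1 {_ ∷ xs} (x<xs ∷ xs<) = begin
  euler (λ _ → 1ℤ) (_ ∷ xs)         ≡⟨ euler-∷ _ x<xs ⟩
  euler (eulerStep n (λ _ → 1ℤ)) xs ≡⟨ euler-cong (λ k → count (+ k) (+ n)) xs ⟩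
  euler (λ _ → + suc n ℤ.* 1ℤ) xs   ≡⟨ euler-*ˡ (+ suc n) _ xs ⟩
  + suc n ℤ.* euler (λ _ → 1ℤ) xs   ≡⟨ cong (+ suc n ℤ.*_) (euler-1 xs<) ⟩
  + suc n ℤ.* + (n !)               ≡⟨ ℤ.pos-* (suc n) (n !) ⟨
  + (suc n !)                       ∎
  where
  n = length xs
  count : ∀ k n → (1ℤ + k) ℤ.* 1ℤ + (n - k) ℤ.* 1ℤ ≡ (1ℤ + n) ℤ.* 1ℤ
  count = solve-∀

ascents≤length : ∀ xs → ascents xs ℕ.≤ length xs
ascents≤length []           = ℕ.z≤n
ascents≤length (a ∷ [])     = ℕ.z≤n
ascents≤length (a ∷ b ∷ xs) = ℕ.+-mono-≤ (bit (a ℕ.<ᵇ b)) (ascents≤length (b ∷ xs))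
  where
  bit : ∀ e → (if e then 1 else 0) ℕ.≤ 1
  bit false = ℕ.z≤n
  bit true  = ℕ.≤-refl

-- Exchanging sums and applying Worpitzky's identity, the sum of b(asc σ) over σ is the alternating
-- power sum, which q divides. Since b(k) ≡ (-1)^k a modulo q, also q divides a D, and a is a unit
-- modulo q.
euler-sign-∣ : ∀ {q} h → q ≡ suc (h ℕ.+ h) → ∀ {n xs} → AllPairs ℕ._<_ xs → length xs ≡ n → DividesChoose q n →
  + q ∣ alt q (λ x → (+ x) ^ n) → + q ∣ euler (-1ℤ ^_) xs
euler-sign-∣ {q} h q-odd {xs = xs} xs< refl H q∣alt =
  subst (+ q ∣_) (recombine ((- + 2) ^ n) D a) (∣m∣n⇒∣m-n (∣n⇒∣m*n ((- + 2) ^ n) q∣aD) (∣m⇒∣m*n D (alt-choose-normalised n H)))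
  where
  open OddLength h q-odd
  n = length xs
  D = euler (-1ℤ ^_) xs
  a = alt q (_choose n)
  b : ℕ → ℤ
  b k = alt q (λ x → (x ℕ.+ k) choose n)
  euler-b : euler b xs ≡ alt q (λ x → (+ x) ^ n)
  euler-b = trans (listSum-∑ q (λ x σ → -1ℤ ^ x ℤ.* (x ℕ.+ ascents σ) choose n) (permutations xs))
    (∑-cong q λ x _ → trans (euler-*ˡ (-1ℤ ^ x) (λ k → (x ℕ.+ k) choose n) xs) (cong (-1ℤ ^ x ℤ.*_) (worpitzky x xs<)))
  euler-diff : euler (λ k → b k + - a ℤ.* -1ℤ ^ k) xs ≡ euler b xs + - a ℤ.* D
  euler-diff = trans (listSum-+ (b ∘ ascents) _ (permutations xs)) (cong (_+_ (euler b xs)) (euler-*ˡ (- a) (-1ℤ ^_) xs))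
  flip : ∀ b s a → b - s ℤ.* a ≡ b + - a ℤ.* s
  flip = solve-∀
  q∣diff : + q ∣ euler b xs + - a ℤ.* D
  q∣diff = subst (+ q ∣_) euler-diff (listSum-∣ (All.map
    (λ {σ} σ↭xs → subst (+ q ∣_) (flip (b (ascents σ)) (-1ℤ ^ ascents σ) a)
      (alt-choose-shift H (ascents σ) (subst (ascents σ ℕ.≤_) (↭-length σ↭xs) (ascents≤length σ))))
    (permutations-↭ xs)))
  negate : ∀ x a D → x - (x + - a ℤ.* D) ≡ a ℤ.* D
  negate = solve-∀
  q∣aD : + q ∣ a ℤ.* D
  q∣aD = subst (+ q ∣_) (negate (euler b xs) a D) (∣m∣n⇒∣m-n (subst (+ q ∣_) (sym euler-b) q∣alt) q∣diff)
  -- With u = (-2)^n, the inverse of a modulo q, this writes D as a difference of multiples of a D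
  -- and of u a - 1, both divisible by q.
  recombine : ∀ u D a → u ℤ.* (a ℤ.* D) - (u ℤ.* a - 1ℤ) ℤ.* D ≡ D
  recombine = solve-∀

-- Parity of the number of ascents

indicator-even : ∀ k → + 2 ℤ.* (if k % 2 ℕ.≡ᵇ 0 then 1ℤ else 0ℤ) ≡ 1ℤ + -1ℤ ^ k
indicator-even zero = refl
indicator-even (suc zero) = refl
indicator-even (suc (suc k)) = begin
  + 2 ℤ.* (if suc (suc k) % 2 ℕ.≡ᵇ 0 then 1ℤ else 0ℤ) ≡⟨ cong (λ r → + 2 ℤ.* (if r ℕ.≡ᵇ 0 then 1ℤ else 0ℤ)) (trans (cong (_% 2) (ℕ.+-comm 2 k)) ([m+n]%n≡m%n k 2)) ⟩
  + 2 ℤ.* (if k % 2 ℕ.≡ᵇ 0 then 1ℤ else 0ℤ)           ≡⟨ indicator-even k ⟩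
  1ℤ + -1ℤ ^ k                                        ≡⟨ cong (_+_ 1ℤ) (square (-1ℤ ^ k)) ⟩
  1ℤ + -1ℤ ^ suc (suc k)                              ∎
  where
  square : ∀ s → s ≡ -1ℤ ℤ.* (-1ℤ ℤ.* s)
  square = solve-∀

2*evenCount : ∀ σs → + (2 ℕ.* length (filter (λ σ → ascents σ % 2 ℕ.≟ 0) σs)) ≡ listSum (λ σ → 1ℤ + -1ℤ ^ ascents σ) σs
2*evenCount [] = refl
2*evenCount (σ ∷ σs)
  -- Abstracting the Boolean test on which `_≟_` is built lets `filter` reduce in the goal and
  -- specialises `indicator-even` along with it.
  with ascents σ % 2 ℕ.≡ᵇ 0 | indicator-even (ascents σ)
... | true  | ind = begin
  + (2 ℕ.* suc l)   ≡⟨ cong +_ (ℕ.*-suc 2 l) ⟩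
  + 2 + + (2 ℕ.* l) ≡⟨ cong₂ _+_ ind (2*evenCount σs) ⟩
  _                 ∎
  where l = length (filter (λ σ → ascents σ % 2 ℕ.≟ 0) σs)
... | false | ind = trans (2*evenCount σs) (trans (sym (ℤ.+-identityˡ _)) (cong (_+ _) ind))

-- Power sums

powerSum : ℕ → ℕ → ℤ
powerSum k n = ∑ n (λ x → (+ x) ^ k)

oddPowerSum : ℕ → ℕ → ℤ
oddPowerSum k h = ∑ h (λ j → (+ suc (j ℕ.+ j)) ^ k)

evenPowerSum : ℕ → ℕ → ℤ
evenPowerSum k h = ∑ h (λ j → (+ (j ℕ.+ j)) ^ k)

-- The first block of p terms is split off, and periodicity replaces the shifted remainder by the
-- sum of the first a p terms.
∑-periodic : ∀ {p f} → (∀ x → + p ∣ f (p ℕ.+ x) - f x) → ∀ a → + p ∣ ∑ (a ℕ.* p) f - + a ℤ.* ∑ p f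
∑-periodic             f-periodic zero    = divides 0ℤ refl
∑-periodic {p} {f} f-periodic (suc a) = subst (+ p ∣_) eq
    (∣m∣n⇒∣m+n (∑-∣- (a ℕ.* p) λ i _ → f-periodic i) (∑-periodic f-periodic a))
  where
  regroup : ∀ a s t u → t - u + (u - a ℤ.* s) ≡ s + t - (1ℤ + a) ℤ.* s
  regroup = solve-∀
  eq : ∑ (a ℕ.* p) (λ i → f (p ℕ.+ i)) - ∑ (a ℕ.* p) f + (∑ (a ℕ.* p) f - + a ℤ.* ∑ p f)
     ≡ ∑ (suc a ℕ.* p) f - + suc a ℤ.* ∑ p f
  eq = trans (regroup (+ a) (∑ p f) (∑ (a ℕ.* p) (λ i → f (p ℕ.+ i))) (∑ (a ℕ.* p) f))
    (cong (_- + suc a ℤ.* ∑ p f) (sym (∑-++ p (a ℕ.* p) f)))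

p∣powerSum : ∀ k p a → + p ∣ + a → + p ∣ powerSum k (a ℕ.* p)
p∣powerSum k p a p∣a = subst (+ p ∣_) (cancel (powerSum k (a ℕ.* p)) (+ a ℤ.* powerSum k p))
    (∣m∣n⇒∣m+n (∑-periodic (λ x → ^-∣- k (subst (+ p ∣_) (isolate (+ p) (+ x)) ∣-refl)) a)
      (∣m⇒∣m*n (powerSum k p) p∣a))
  where
  isolate : ∀ p x → p ≡ p + x - x
  isolate = solve-∀
  cancel : ∀ s t → s - t + t ≡ s
  cancel = solve-∀

^-expand : ∀ q y n → q ℤ.* q ∣ (q + y) ^ suc n - y ^ suc n - + suc n ℤ.* q ℤ.* y ^ n
^-expand q y zero    = divides 0ℤ (eq q y)
  where
  eq : ∀ q y → (q + y) ℤ.* 1ℤ - y ℤ.* 1ℤ - 1ℤ ℤ.* q ℤ.* 1ℤ ≡ 0ℤ ℤ.* (q ℤ.* q)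
  eq = solve-∀
^-expand q y (suc n) = subst (q ℤ.* q ∣_) (eq (+ n) q y (y ^ n) ((q + y) ^ suc n))
    (∣m∣n⇒∣m+n (∣n⇒∣m*n (q + y) (^-expand q y n)) (∣n⇒∣m*n (+ suc n ℤ.* y ^ n) ∣-refl))
  where
  eq : ∀ n q y u v →
    (q + y) ℤ.* (v - y ℤ.* u - (1ℤ + n) ℤ.* q ℤ.* u) + (1ℤ + n) ℤ.* u ℤ.* (q ℤ.* q) ≡
    (q + y) ℤ.* v - y ℤ.* (y ℤ.* u) - (1ℤ + (1ℤ + n)) ℤ.* q ℤ.* (y ℤ.* u)
  eq = solve-∀

module _ {q} h (q-odd : q ≡ suc (h ℕ.+ h)) where

  -- Doubling permutes the residues modulo q; the doubles exceeding q are the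
  -- numbers q + y with y odd, and they account for the first-order term.
  powerSum-doubling : ∀ n → + q ℤ.* + q ∣
    ((+ 2) ^ suc n - 1ℤ) ℤ.* powerSum (suc n) q - + suc n ℤ.* + q ℤ.* oddPowerSum n h
  powerSum-doubling n = subst (+ q ℤ.* + q ∣_) eq (∑-∣ h λ j _ → ^-expand (+ q) (+ suc (j ℕ.+ j)) n)
    where
    k = suc n
    E = evenPowerSum k (suc h)
    O = oddPowerSum k h
    G = ∑ h (λ j → (+ q + + suc (j ℕ.+ j)) ^ k)
    double : ∀ x → (+ 2 ℤ.* + x) ^ k ≡ (+ (x ℕ.+ x)) ^ k
    double x = cong (_^ k) (2x (+ x))
      where
      2x : ∀ x → + 2 ℤ.* x ≡ x + x
      2x = solve-∀
    wrap : ∀ j → suc h ℕ.+ j ℕ.+ (suc h ℕ.+ j) ≡ q ℕ.+ suc (j ℕ.+ j)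
    wrap j = trans (comm h j) (cong (ℕ._+ suc (j ℕ.+ j)) (sym q-odd))
      where
      comm : ∀ h j → suc h ℕ.+ j ℕ.+ (suc h ℕ.+ j) ≡ suc (h ℕ.+ h) ℕ.+ suc (j ℕ.+ j)
      comm = ℕ-Solver.solve-∀
    doubled : (+ 2) ^ k ℤ.* powerSum k q ≡ E + G
    doubled = begin
      (+ 2) ^ k ℤ.* powerSum k q                ≡⟨ ∑-*ˡ q ((+ 2) ^ k) (λ x → (+ x) ^ k) ⟨
      ∑ q (λ x → (+ 2) ^ k ℤ.* (+ x) ^ k)       ≡⟨ ∑-cong q (λ x _ → trans (sym (^-distrib-* (+ 2) (+ x) k)) (double x)) ⟩
      ∑ q (λ x → (+ (x ℕ.+ x)) ^ k)             ≡⟨ cong (λ l → ∑ l (λ x → (+ (x ℕ.+ x)) ^ k)) q-odd ⟩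
      ∑ (suc h ℕ.+ h) (λ x → (+ (x ℕ.+ x)) ^ k) ≡⟨ ∑-++ (suc h) h (λ x → (+ (x ℕ.+ x)) ^ k) ⟩
      E + ∑ h (λ j → (+ (suc h ℕ.+ j ℕ.+ (suc h ℕ.+ j))) ^ k)
        ≡⟨ cong (_+_ E) (∑-cong h λ j _ → cong (λ x → (+ x) ^ k) (wrap j)) ⟩
      E + G ∎
    split : powerSum k q ≡ E + O
    split = trans (cong (powerSum k) q-odd) (∑-parity h (λ x → (+ x) ^ k))
    c = + k ℤ.* + q
    ∑-split : ∑ h (λ j → (+ q + + suc (j ℕ.+ j)) ^ k - (+ suc (j ℕ.+ j)) ^ k - c ℤ.* (+ suc (j ℕ.+ j)) ^ n)
            ≡ G - O - c ℤ.* oddPowerSum n h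
    ∑-split = begin
      ∑ h (λ j → (+ q + + suc (j ℕ.+ j)) ^ k - (+ suc (j ℕ.+ j)) ^ k - c ℤ.* (+ suc (j ℕ.+ j)) ^ n)
        ≡⟨ ∑-- h (λ j → (+ q + + suc (j ℕ.+ j)) ^ k - (+ suc (j ℕ.+ j)) ^ k) (λ j → c ℤ.* (+ suc (j ℕ.+ j)) ^ n) ⟩
      ∑ h (λ j → (+ q + + suc (j ℕ.+ j)) ^ k - (+ suc (j ℕ.+ j)) ^ k) - ∑ h (λ j → c ℤ.* (+ suc (j ℕ.+ j)) ^ n)
        ≡⟨ cong₂ _-_ (∑-- h (λ j → (+ q + + suc (j ℕ.+ j)) ^ k) (λ j → (+ suc (j ℕ.+ j)) ^ k))
                     (∑-*ˡ h c (λ j → (+ suc (j ℕ.+ j)) ^ n)) ⟩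
      G - O - c ℤ.* oddPowerSum n h ∎
    eq : ∑ h (λ j → (+ q + + suc (j ℕ.+ j)) ^ k - (+ suc (j ℕ.+ j)) ^ k - c ℤ.* (+ suc (j ℕ.+ j)) ^ n)
       ≡ ((+ 2) ^ k - 1ℤ) ℤ.* powerSum k q - c ℤ.* oddPowerSum n h
    eq = trans ∑-split (cong (_- c ℤ.* oddPowerSum n h) (begin
      G - O                                     ≡⟨ insert E G O ⟩
      E + G - (E + O)                           ≡⟨ cong₂ _-_ doubled split ⟨
      (+ 2) ^ k ℤ.* powerSum k q - powerSum k q ≡⟨ factor ((+ 2) ^ k) (powerSum k q) ⟩
      ((+ 2) ^ k - 1ℤ) ℤ.* powerSum k q            ∎))
      where
      insert : ∀ e g o → g - o ≡ e + g - (e + o)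
      insert = solve-∀
      factor : ∀ t s → t ℤ.* s - s ≡ (t - 1ℤ) ℤ.* s
      factor = solve-∀

  -- The even numbers 2, ..., 2 h are q - y for the odd y in 1, ..., 2 h - 1, and q - y ≡ -y modulo
  -- q.
  evenPowerSum-reflect : ∀ n → + q ∣ evenPowerSum (suc n) (suc h) - -1ℤ ^ suc n ℤ.* oddPowerSum (suc n) h
  evenPowerSum-reflect n = subst (+ q ∣_) eq (∑-∣- h reflect)
    where
    k = suc n
    term : ℕ → ℤ
    term i = (+ (i ℕ.+ i)) ^ k
    eq : ∑ h (λ i → term (suc (h ∸ suc i))) - ∑ h (λ j → -1ℤ ^ k ℤ.* (+ suc (j ℕ.+ j)) ^ k)
       ≡ evenPowerSum k (suc h) - -1ℤ ^ k ℤ.* oddPowerSum k h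
    eq = cong₂ _-_
      (begin
        ∑ h (λ i → term (suc (h ∸ suc i))) ≡⟨ ∑-reverse h (term ∘ suc) ⟨
        -- `term 0` reduces to 0 because the exponent `suc n` is positive.
        ∑ h (term ∘ suc)                   ≡⟨ ℤ.+-identityˡ _ ⟨
        term 0 + ∑ h (term ∘ suc)          ≡⟨ ∑-head h term ⟨
        evenPowerSum k (suc h)                ∎)
      (∑-*ˡ h (-1ℤ ^ k) (λ j → (+ suc (j ℕ.+ j)) ^ k))
    reflect : ∀ j → j ℕ.< h → + q ∣ term (suc (h ∸ suc j)) - -1ℤ ^ k ℤ.* (+ suc (j ℕ.+ j)) ^ k
    reflect j j<h = subst (λ y → + q ∣ term r - y) (^-distrib-* -1ℤ (+ suc (j ℕ.+ j)) k)
        (^-∣- {x = + (r ℕ.+ r)} {y = -1ℤ ℤ.* + suc (j ℕ.+ j)} k (subst (+ q ∣_) sum≡q ∣-refl))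
      where
      -- This is h - j, so that 2 r = q - (2 j + 1).
      r = suc (h ∸ suc j)
      r+j≡h : r ℕ.+ j ≡ h
      r+j≡h = trans (sym (ℕ.+-suc (h ∸ suc j) j)) (ℕ.m∸n+n≡m j<h)
      rearrange : ∀ r j → 1ℤ + (r + j + (r + j)) ≡ r + r - -1ℤ ℤ.* (1ℤ + (j + j))
      rearrange = solve-∀
      sum≡q : + q ≡ + (r ℕ.+ r) - -1ℤ ℤ.* + suc (j ℕ.+ j)
      sum≡q = trans (cong +_ (trans q-odd (cong (λ h → suc (h ℕ.+ h)) (sym r+j≡h)))) (rearrange (+ r) (+ j))

  -- By `powerSum-doubling` q² divides k q O; cancelling q and the coprime factor k gives q ∣ O. The
  -- alternating sum is E - O, which by reflection is a multiple of O modulo q.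
  q∣altPowerSum : .{{NonZero q}} → ∀ n → Coprime q (suc (suc n)) →
    + q ℤ.* + q ∣ ((+ 2) ^ suc (suc n) - 1ℤ) ℤ.* powerSum (suc (suc n)) q →
    + q ∣ alt q (λ x → (+ x) ^ suc n)
  q∣altPowerSum n q⊥k q²∣S = subst (+ q ∣_) eq
      (∣m∣n⇒∣m+n (evenPowerSum-reflect n) (∣n⇒∣m*n (-1ℤ ^ suc n - 1ℤ) q∣O))
    where
    k = suc (suc n)
    E = evenPowerSum (suc n) (suc h)
    O = oddPowerSum (suc n) h
    S = ((+ 2) ^ k - 1ℤ) ℤ.* powerSum k q
    isolate : ∀ s k q o → s - (s - k ℤ.* q ℤ.* o) ≡ q ℤ.* (k ℤ.* o)
    isolate = solve-∀
    q∣O : + q ∣ O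
    q∣O = coprime-cancelˡ O q⊥k (*-cancelˡ-∣ (+ q) (subst (+ q ℤ.* + q ∣_) (isolate S (+ k) (+ q) O)
      (∣m∣n⇒∣m-n q²∣S (powerSum-doubling (suc n)))))
    regroup : ∀ e s o → e - s ℤ.* o + (s - 1ℤ) ℤ.* o ≡ e - o
    regroup = solve-∀
    eq : E - -1ℤ ^ suc n ℤ.* O + (-1ℤ ^ suc n - 1ℤ) ℤ.* O ≡ alt q (λ x → (+ x) ^ suc n)
    eq = trans (regroup E (-1ℤ ^ suc n) O) (sym (OddLength.alt-parity h q-odd (λ x → (+ x) ^ suc n)))

-- Odd numbers and powers of a prime

∣-* : ∀ {a b x y} → a ∣ x → b ∣ y → a ℤ.* b ∣ x ℤ.* y
∣-* {a} {b} {x} {y} a∣x b∣y = ∣-trans (*-monoʳ-∣ a b∣y) (*-monoˡ-∣ y a∣x)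

odd⇒1+h+h : ∀ n → n % 2 ≡ 1 → n ≡ suc (n / 2 ℕ.+ n / 2)
odd⇒1+h+h n n-odd = trans (m≡m%n+[m/n]*n n 2) (cong₂ ℕ._+_ n-odd (double (n / 2)))
  where
  double : ∀ h → h * 2 ≡ h ℕ.+ h
  double = ℕ-Solver.solve-∀

odd-square : ∀ h → let m = 2 * (h * h ℕ.+ h) in suc (h ℕ.+ h) ℕ.^ 2 ≡ suc (m ℕ.+ m)
odd-square = expand
  where
  expand : ∀ h → suc (h ℕ.+ h) * (suc (h ℕ.+ h) * 1) ≡ suc (2 * (h * h ℕ.+ h) ℕ.+ 2 * (h * h ℕ.+ h))
  expand = ℕ-Solver.solve-∀

prime-^-dividesChoose : ∀ {p n} k → .{{NonZero p}} → Prime p → n ℕ.< p → DividesChoose (p ℕ.^ k) n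
prime-^-dividesChoose {p} k p-prime n<p =
  coprime⇒dividesChoose {{ℕ.m^n≢0 p k}} λ j<n → prime-^-coprime k p-prime (ℕ.≤-<-trans j<n n<p)

-- Consequences of the hypotheses on p

-- Fermat's little theorem for base 2 is the case q = p, n = p - 1 of `alt-choose-normalised`: only
-- x = n contributes to the alternating sum of C(x, n), which is thus (-1)^n, and (-2)^n (-1)^n =
-- 2^n.
fermat₂ : ∀ {n} → Prime (suc n) → suc n % 2 ≡ 1 → + suc n ∣ (+ 2) ^ n - 1ℤ
fermat₂ {n} p-prime p-odd = subst (+ suc n ∣_) (cong (_- 1ℤ) eq) (alt-choose-normalised n
    (coprime⇒dividesChoose λ j<n → prime⇒coprime p-prime (ℕ.s≤s j<n)))
  where
  open OddLength (suc n / 2) (odd⇒1+h+h (suc n) p-odd)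
  eq : (- + 2) ^ n ℤ.* alt (suc n) (_choose n) ≡ (+ 2) ^ n
  eq = begin
    (- + 2) ^ n ℤ.* (∑ n (λ x → -1ℤ ^ x ℤ.* x choose n) + -1ℤ ^ n ℤ.* n choose n)
      ≡⟨ cong (λ s → (- + 2) ^ n ℤ.* (s + -1ℤ ^ n ℤ.* n choose n)) low ⟩
    (- + 2) ^ n ℤ.* (0ℤ + -1ℤ ^ n ℤ.* n choose n)
      ≡⟨ cong (λ c → (- + 2) ^ n ℤ.* (0ℤ + -1ℤ ^ n ℤ.* + c)) (nCn≡1 n) ⟩
    (- + 2) ^ n ℤ.* (0ℤ + -1ℤ ^ n ℤ.* 1ℤ)
      ≡⟨ simplify ((- + 2) ^ n) (-1ℤ ^ n) ⟩
    (- + 2) ^ n ℤ.* -1ℤ ^ n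
      ≡⟨ ^-distrib-* (- + 2) -1ℤ n ⟨
    (+ 2) ^ n ∎
    where
    simplify : ∀ a b → a ℤ.* (0ℤ + b ℤ.* 1ℤ) ≡ a ℤ.* b
    simplify = solve-∀
    low : ∑ n (λ x → -1ℤ ^ x ℤ.* x choose n) ≡ 0ℤ
    low = begin
      ∑ n (λ x → -1ℤ ^ x ℤ.* x choose n)
        ≡⟨ ∑-cong n (λ x x<n → trans (cong (λ c → -1ℤ ^ x ℤ.* + c) (k>n⇒nCk≡0 x<n)) (ℤ.*-zeroʳ (-1ℤ ^ x))) ⟩
      ∑ n (λ _ → 0ℤ ℤ.* 0ℤ) ≡⟨ ∑-*ˡ n 0ℤ (λ _ → 0ℤ) ⟩
      0ℤ                    ∎

-- The quotient in `SuperWieferich` is a truncated division; `fermat₂` makes it exact, so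
-- multiplying by p raises p² to p³.
superWieferich⇒p³∣ : ∀ {n} → Prime (suc n) → suc n % 2 ≡ 1 → SuperWieferich (suc n) →
  + (suc n ℕ.^ 3) ∣ (+ 2) ^ n - 1ℤ
superWieferich⇒p³∣ {n} p-prime p-odd p²∣quotient = subst (+ (suc n ℕ.^ 3) ∣_) cast (∣ᵤ⇒∣ p³∣)
  where
  p = suc n
  1≤2^n : 1 ℕ.≤ 2 ℕ.^ n
  1≤2^n = ℕ.>-nonZero⁻¹ (2 ℕ.^ n) {{ℕ.m^n≢0 2 n}}
  cast : + (2 ℕ.^ n ∸ 1) ≡ (+ 2) ^ n - 1ℤ
  cast = begin
    + (2 ℕ.^ n ∸ 1)  ≡⟨ ℤ.⊖-≥ 1≤2^n ⟨
    2 ℕ.^ n ⊖ 1      ≡⟨ ℤ.m-n≡m⊖n (2 ℕ.^ n) 1 ⟨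
    + (2 ℕ.^ n) - 1ℤ ≡⟨ cong (_- 1ℤ) (pos-^ 2 n) ⟩
    (+ 2) ^ n - 1ℤ   ∎
  p∣ : p ℕ.∣ 2 ℕ.^ n ∸ 1
  p∣ = ∣⇒∣ᵤ (subst (+ p ∣_) (sym cast) (fermat₂ p-prime p-odd))
  p³∣ : p ℕ.^ 3 ℕ.∣ 2 ℕ.^ n ∸ 1
  p³∣ = subst (p ℕ.^ 3 ℕ.∣_) (m*[n/m]≡n p∣) (ℕ.*-monoʳ-∣ p p²∣quotient)

-- With q = p² and k = p - 1, the factor p³ of 2^k - 1 and the factor p of the power sum multiply to
-- p⁴ = q², as `q∣altPowerSum` demands.
signSum-divisible : ∀ {n xs} → let p = suc (suc (suc n)) in
  Prime p → p % 2 ≡ 1 → SuperWieferich p → AllPairs ℕ._<_ xs → length xs ≡ suc n →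
  + (p ℕ.^ 2) ∣ euler (-1ℤ ^_) xs
signSum-divisible {n} p-prime p-odd superWieferich xs< len =
  euler-sign-∣ m q-odd xs< len (prime-^-dividesChoose 2 p-prime (ℕ.m≤n⇒m≤1+n ℕ.≤-refl))
    (q∣altPowerSum m q-odd {{ℕ.m^n≢0 p 2}} n (prime-^-coprime 2 p-prime ℕ.≤-refl) q²∣)
  where
  p = suc (suc (suc n))
  k = suc (suc n)
  q = p ℕ.^ 2
  h = p / 2
  m = 2 * (h * h ℕ.+ h)
  q-odd : q ≡ suc (m ℕ.+ m)
  q-odd = trans (cong (ℕ._^ 2) (odd⇒1+h+h p p-odd)) (odd-square h)
  p∣S : + p ∣ powerSum k q
  p∣S = subst (λ l → + p ∣ powerSum k l) (cong (p *_) (sym (ℕ.*-identityʳ p))) (p∣powerSum k p p ∣-refl)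
  p³p≡q² : + (p ℕ.^ 3) ℤ.* + p ≡ + q ℤ.* + q
  p³p≡q² = begin
    + (p ℕ.^ 3) ℤ.* + p ≡⟨ ℤ.pos-* (p ℕ.^ 3) p ⟨
    + (p ℕ.^ 3 * p)     ≡⟨ cong +_ (regroup p) ⟩
    + (q * q)           ≡⟨ ℤ.pos-* q q ⟩
    + q ℤ.* + q         ∎
    where
    regroup : ∀ p → p * (p * (p * 1)) * p ≡ p * (p * 1) * (p * (p * 1))
    regroup = ℕ-Solver.solve-∀
  q²∣ : + q ℤ.* + q ∣ ((+ 2) ^ k - 1ℤ) ℤ.* powerSum k q
  q²∣ = subst (_∣ ((+ 2) ^ k - 1ℤ) ℤ.* powerSum k q) p³p≡q² (∣-* (superWieferich⇒p³∣ p-prime p-odd superWieferich) p∣S)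

-- The values of `2 * N n` and of the factorial modulo p²

sucs-sorted : ∀ n → AllPairs ℕ._<_ (map suc (upTo n))
sucs-sorted n = AllPairs.map⁺ (AllPairs.applyUpTo⁺₁ id n λ i<j _ → ℕ.s≤s i<j)

length-sucs : ∀ n → length (map suc (upTo n)) ≡ n
length-sucs n = trans (length-map suc (upTo n)) (length-upTo n)

2*N≡n!+signSum : ∀ n → + (2 * N n) ≡ + (n !) + euler (-1ℤ ^_) (map suc (upTo n))
2*N≡n!+signSum n = begin
  + (2 * N n)                                            ≡⟨ 2*evenCount (permutations xs) ⟩
  listSum (λ σ → 1ℤ + -1ℤ ^ ascents σ) (permutations xs) ≡⟨ listSum-+ (λ _ → 1ℤ) _ (permutations xs) ⟩
  euler (λ _ → 1ℤ) xs + euler (-1ℤ ^_) xs                ≡⟨ cong (_+ euler (-1ℤ ^_) xs) (euler-1 (sucs-sorted n)) ⟩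
  + (length xs !) + euler (-1ℤ ^_) xs                    ≡⟨ cong (λ l → + (l !) + euler (-1ℤ ^_) xs) (length-sucs n) ⟩
  + (n !) + euler (-1ℤ ^_) xs                            ∎
  where xs = map suc (upTo n)

-- As (p - 1)(p + 1) = p² - 1, the number (p - 1)! + 1 - p² factors as (p - 1)((p - 2)! - (1 + p)),
-- and p - 1 is coprime to p².
wilson⇒[p-2]!≡1+p : ∀ {n} → Prime (suc (suc n)) → Wilson (suc (suc n)) →
  + (suc (suc n) ℕ.^ 2) ∣ + (n !) - + suc (suc (suc n))
wilson⇒[p-2]!≡1+p {n} p-prime wilson = coprime-cancelˡ _ (prime-^-coprime 2 p-prime ℕ.≤-refl)
    (subst (+ q ∣_) eq (∣m∣n⇒∣m-n (∣ᵤ⇒∣ {+ q} {+ (suc n ! ℕ.+ 1)} wilson) (∣-refl {+ q})))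
  where
  p = suc (suc n)
  q = p ℕ.^ 2
  regroup : ∀ n f → (1ℤ + n) ℤ.* f + 1ℤ - (1ℤ + (1ℤ + n)) ℤ.* (1ℤ + (1ℤ + n)) ≡ (1ℤ + n) ℤ.* (f - (1ℤ + (1ℤ + (1ℤ + n))))
  regroup = solve-∀
  eq : + (suc n ! ℕ.+ 1) - + q ≡ + suc n ℤ.* (+ (n !) - + suc (suc (suc n)))
  eq = begin
    + (suc n !) + 1ℤ - + q
      ≡⟨ cong₂ (λ a b → a + 1ℤ - b) (ℤ.pos-* (suc n) (n !))
           (trans (cong (+_ ∘ (p *_)) (ℕ.*-identityʳ p)) (ℤ.pos-* p p)) ⟩
    + suc n ℤ.* + (n !) + 1ℤ - + p ℤ.* + p      ≡⟨ regroup (+ n) (+ (n !)) ⟩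
    + suc n ℤ.* (+ (n !) - + suc (suc (suc n))) ∎

-- Remainders and base-p digits

%-unique : ∀ {q} x r → .{{_ : NonZero q}} → r ℕ.< q → + q ∣ + x - + r → x % q ≡ r
%-unique {q} x r r<q q∣x-r with ℕ.≤-<-connex r x
... | inj₁ r≤x = begin
  x % q               ≡⟨ cong (_% q) (ℕ.m+[n∸m]≡n r≤x) ⟨
  (r ℕ.+ (x ∸ r)) % q ≡⟨ %-remove-+ʳ r (subst (q ℕ.∣_) (cong ∣_∣ (trans (ℤ.m-n≡m⊖n x r) (ℤ.⊖-≥ r≤x))) (∣⇒∣ᵤ q∣x-r)) ⟩
  r % q               ≡⟨ m<n⇒m%n≡m r<q ⟩
  r                   ∎
... | inj₂ x<r = contradiction
  (ℕ.∣⇒≤ {{ℕ.>-nonZero (ℕ.m<n⇒0<n∸m x<r)}}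
    (subst (q ℕ.∣_) (trans (cong ∣_∣ (ℤ.m-n≡m⊖n x r)) (ℤ.∣⊖∣-≤ (ℕ.<⇒≤ x<r))) (∣⇒∣ᵤ q∣x-r)))
  (ℕ.<⇒≱ (ℕ.≤-<-trans (ℕ.m∸n≤m r x) r<q))

-- Since 1 + p < p², the remainder of x modulo p² is 1 + p itself, written 11 in base p, and both
-- digits are read from it.
1+p-digits : ∀ p x → .{{_ : NonZero p}} → 1 ℕ.< p → + (p ℕ.^ 2) ∣ + x - + suc p → digit p x 0 ≡ 1 × digit p x 1 ≡ 1
1+p-digits p x 1<p p²∣ = digit₀ , digit₁
  where
  q = p ℕ.^ 2
  instance
    p^1≢0 : NonZero (p ℕ.^ 1)
    p^1≢0 = ℕ.m^n≢0 p 1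
    q≢0 : NonZero (p ℕ.^ 2)
    q≢0 = ℕ.m^n≢0 p 2
  1+p<q : suc p ℕ.< q
  1+p<q = ℕ.<-≤-trans (ℕ.+-monoˡ-< p 1<p) (subst (ℕ._≤ q) (p*2 p)
    (ℕ.*-monoʳ-≤ p (subst (2 ℕ.≤_) (sym (ℕ.*-identityʳ p)) 1<p)))
    where
    p*2 : ∀ p → p * 2 ≡ p ℕ.+ p
    p*2 = ℕ-Solver.solve-∀
  x%q≡1+p : x % q ≡ suc p
  x%q≡1+p = %-unique x (suc p) 1+p<q p²∣
  digit₀ : digit p x 0 ≡ 1
  digit₀ = begin
    (x / 1) % p   ≡⟨ cong (_% p) (n/1≡n x) ⟩
    x % p         ≡⟨ m∣n⇒o%n%m≡o%m p q x (ℕ.m∣m*n (p ℕ.^ 1)) ⟨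
    x % q % p     ≡⟨ cong (_% p) x%q≡1+p ⟩
    (1 ℕ.+ p) % p ≡⟨ [m+n]%n≡m%n 1 p ⟩
    1 % p         ≡⟨ m<n⇒m%n≡m 1<p ⟩
    1             ∎
  digit₁ : digit p x 1 ≡ 1
  digit₁ = begin
    x / p ℕ.^ 1 % p       ≡⟨ m%[n*o]/o≡m/o%n x p (p ℕ.^ 1) ⟨
    x % q / p ℕ.^ 1       ≡⟨ cong (_/ p ℕ.^ 1) x%q≡1+p ⟩
    suc p / p ℕ.^ 1       ≡⟨ /-congʳ (ℕ.*-identityʳ p) ⟩
    suc p / p             ≡⟨ m/n≡1+[m∸n]/n (ℕ.n≤1+n p) ⟩
    1 ℕ.+ (suc p ∸ p) / p ≡⟨ cong (λ d → 1 ℕ.+ d / p) (ℕ.m+n∸n≡m 1 p) ⟩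
    1 ℕ.+ 1 / p           ≡⟨ cong suc (m<n⇒m/n≡0 1<p) ⟩
    1                     ∎

theorem14 : (p : ℕ) → .{{_ : NonZero p}} → Prime p → p % 2 ≡ 1 →
    Wilson p → SuperWieferich p →
    digit p (2 * N (p ∸ 2)) 0 ≡ 1 × digit p (2 * N (p ∸ 2)) 1 ≡ 1
-- The values 0 and 2 contradict `p % 2 ≡ 1`, and 1 is not prime; hence p is at least 3 in the last
-- clause.
theorem14 (suc zero) p-prime _ _ _ = contradiction p-prime ¬prime[1]
theorem14 p@(suc (suc (suc n))) p-prime p-odd wilson superWieferich =
  1+p-digits p (2 * N (suc n)) (ℕ.s≤s (ℕ.s≤s ℕ.z≤n)) (subst (+ (p ℕ.^ 2) ∣_) eq
    (∣m∣n⇒∣m+n (wilson⇒[p-2]!≡1+p p-prime wilson)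
      (signSum-divisible p-prime p-odd superWieferich (sucs-sorted (suc n)) (length-sucs (suc n)))))
  where
  D = euler (-1ℤ ^_) (map suc (upTo (suc n)))
  swap : ∀ f r d → f - r + d ≡ f + d - r
  swap = solve-∀
  eq : + (suc n !) - + suc p + D ≡ + (2 * N (suc n)) - + suc p
  eq = trans (swap (+ (suc n !)) (+ suc p) D) (cong (_- + suc p) (sym (2*N≡n!+signSum (suc n))))
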